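{- Let $\lambda=\langle1^{m_1},2^{m_2},\dots,k^{m_k}\rangle$ with all $m_i>0$, $n\ge1$, $x_1,\dots,x_n>0$, $t>0$, and put $M_j=m_j+\dots+m_k$, $M_{k+1}=0$. For $1\le j\le k$, the stationary current of species $j$ in the mTAZRP of type $\lambda$ on $n$ sites, i.e. $\sum_w\pi(w)\,x_1^{ -1}t^{d_j(w)}[c_j(w)]_t$ where $\pi$ is the stationary distribution and $c_j(w)$, $d_j(w)$ are the numbers of particles at site $1$ of species $j$ and of species $>j$ respectively, equals $$[M_j]_t\frac{\widetilde H_{\langle1^{M_j-1}\rangle}(x;1,t)}{\widetilde H_{\langle1^{M_j}\rangle}(x;1,t)}-[M_{j+1}]_t\frac{\widetilde H_{\langle1^{M_{j+1}-1}\rangle}(x;1,t)}{\widetilde H_{\langle1^{M_{j+1}}\rangle}(x;1,t)},$$ where the second term is $0$ when $j=k$ and $x=(x_1,\dots,x_n)$.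
   Context: mTAZRP: for a partition $\lambda$ and $n\ge1$, sites $1,\dots,n$ on a ring (site $n+1$ is site $1$); a configuration assigns to each site a multiset of species with union the multiset of parts of $\lambda$; if site $j$ has $c$ particles of species $r$ and $d$ of species larger than $r$, a particle of species $r$ jumps from $j$ to $j+1$ at rate $x_j^{ -1}t^d[c]_t$. $\langle1^{m_1},\dots,k^{m_k}\rangle$ is the partition with part $i$ occurring $m_i$ times. Notation: $[a]_t=1+t+\dots+t^{a-1}$ ($[0]_t=0$), $[a]_t!=\prod_{b\le a}[b]_t$, $\begin{bmatrix}m\\ \eta_1,\dots,\eta_n\end{bmatrix}_t=[m]_t!/\prod_i[\eta_i]_t!$, $\widetilde H_{\langle1^m\rangle}(x_1,\dots,x_n;1,t)=\sum_{\eta_1+\dots+\eta_n=m,\ \eta_i\ge0}\begin{bmatrix}m\\ \eta_1,\dots,\eta_n\end{bmatrix}_t\prod_i x_i^{\eta_i}$, with $\widetilde H_{\langle1^0\rangle}=1$. -}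

module Defs where

open import Algebra.Bundles using (CommutativeRing; Semiring)
open import Algebra.Core using (Op₁; Op₂)
open import Algebra.Structures using (IsCommutativeRing)
import Algebra.Definitions.RawSemiring as RawSemiringDefs
open import Data.Fin.Base using (Fin; zero; toℕ)
open import Data.List.Base as List using (List; []; _∷_; _++_; concatMap; upTo)
open import Data.List.Membership.Propositional using (_∈_)
open import Data.List.Membership.Propositional.Properties
  using (∈-map⁺; ∈-map⁻; ∈-++⁺ˡ; ∈-++⁺ʳ; ∈-++⁻; ∈-upTo⁺; ∈-upTo⁻)
open import Data.List.Relation.Unary.Any using (here; there)
open import Data.List.Relation.Unary.All as ListAll using ()
open import Data.List.Relation.Unary.All.Properties using (All¬⇒¬Any)
open import Data.List.Relation.Unary.Unique.Propositional using (Unique; []; _∷_)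
import Data.List.Relation.Unary.Unique.Propositional.Properties as Unique
open import Data.Nat.Base as ℕ using (ℕ; zero; suc; pred; _∸_; s≤s; s≤s⁻¹)
import Data.Nat.Properties as ℕ
open import Data.Nat.DivMod using (_mod_)
open import Data.Product.Base using (_×_; _,_)
open import Data.Sum.Base using (_⊎_; inj₁; inj₂)
open import Data.Vec.Base as Vec using (Vec; []; _∷_; lookup; updateAt; toList)
import Data.Vec.Properties as Vec
open import Data.Vec.Functional using (Vector)
open import Data.Bool.Base using (if_then_else_)
open import Level using (_⊔_) renaming (suc to lsuc)
open import Relation.Binary.Core using (Rel)
open import Relation.Binary.Definitions using (DecidableEquality)
open import Relation.Binary.PropositionalEquality.Core using (_≡_; refl; cong; cong₂; sym; trans)
open import Relation.Binary.Structures using (IsStrictTotalOrder)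
open import Relation.Nullary.Decidable.Core using (does)
open import Relation.Nullary.Negation.Core using (¬_)

-- The scalars are an arbitrary ordered field, the real numbers being the
-- intended example.  Inversion is total with an unspecified value at 0.
record OrderedField c ℓ₁ ℓ₂ : Set (lsuc (c ⊔ ℓ₁ ⊔ ℓ₂)) where
  infix  9 _⁻¹
  infix  8 -_
  infixl 7 _*_ _/_
  infixl 6 _+_ _-_
  infix  4 _≈_ _<_ _≤_
  field
    Carrier            : Set c
    _≈_                : Rel Carrier ℓ₁
    _<_                : Rel Carrier ℓ₂
    _+_                : Op₂ Carrier
    _*_                : Op₂ Carrier
    -_                 : Op₁ Carrier
    _⁻¹                : Op₁ Carrier
    0#                 : Carrier
    1#                 : Carrier
    isCommutativeRing  : IsCommutativeRing _≈_ _+_ _*_ -_ 0# 1#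
    isStrictTotalOrder : IsStrictTotalOrder _≈_ _<_
    0≉1                : ¬ (0# ≈ 1#)
    ⁻¹-cong            : ∀ {x y} → x ≈ y → x ⁻¹ ≈ y ⁻¹
    *-inverseʳ         : ∀ {x} → ¬ (x ≈ 0#) → x * x ⁻¹ ≈ 1#
    +-monoˡ-<          : ∀ {x y} z → x < y → x + z < y + z
    *-pos              : ∀ {x y} → 0# < x → 0# < y → 0# < x * y

  commutativeRing : CommutativeRing c ℓ₁
  commutativeRing = record { isCommutativeRing = isCommutativeRing }

  open RawSemiringDefs (Semiring.rawSemiring (CommutativeRing.semiring commutativeRing)) public using (_^_; sum; product)

  _-_ : Op₂ Carrier
  x - y = x + (- y)

  _/_ : Op₂ Carrier
  x / y = x * y ⁻¹

  _≤_ : Rel Carrier (ℓ₁ ⊔ ℓ₂)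
  x ≤ y = x < y ⊎ x ≈ y

consAll : ∀ {a} {A : Set a} {n} → List A → (A → List (Vec A n)) → List (Vec A (suc n))
consAll xs f = concatMap (λ x → List.map (x ∷_) (f x)) xs

-- All η = (η₁,…,ηₙ) with ηᵢ ≥ 0 and η₁ + ⋯ + ηₙ = m.
compositions : (n m : ℕ) → List (Vec ℕ n)
compositions zero    zero    = [] ∷ []
compositions zero    (suc m) = []
compositions (suc n) m       = consAll (upTo (suc m)) (λ a → compositions n (m ∸ a))

-- A particle configuration with k species on n sites: row r, entry s is the
-- number of particles of species r at site s.  The r-th element of Fin k
-- (counting from zero) stands for species r + 1, so the order on Fin k is the
-- order of species.
Config : (n k : ℕ) → Set
Config n k = Vec (Vec ℕ n) k

_≟ᶜ_ : ∀ {n k} → DecidableEquality (Config n k)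
_≟ᶜ_ = Vec.≡-dec (Vec.≡-dec ℕ._≟_)

-- All configurations of type ⟨1^m₁,…,k^mₖ⟩; see ∈-configs⁺, ∈-configs⁻ and
-- configs-unique.
configs : ∀ n {k} → Vec ℕ k → List (Config n k)
configs n []       = [] ∷ []
configs n (m ∷ ms) = consAll (compositions n m) (λ _ → configs n ms)

module _ {a} {A : Set a} {n : ℕ} where

  ∈-consAll⁺ : ∀ {xs} {f : A → List (Vec A n)} {x v} →
               x ∈ xs → v ∈ f x → (x ∷ v) ∈ consAll xs f
  ∈-consAll⁺ (here refl) v∈ = ∈-++⁺ˡ (∈-map⁺ _ v∈)
  ∈-consAll⁺ {f = f} (there {x = y} x∈) v∈ =
    ∈-++⁺ʳ (List.map (y ∷_) (f y)) (∈-consAll⁺ x∈ v∈)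

  ∈-consAll⁻ : ∀ xs {f : A → List (Vec A n)} {x v} →
               (x ∷ v) ∈ consAll xs f → x ∈ xs × v ∈ f x
  ∈-consAll⁻ (y ∷ xs) {f} p with ∈-++⁻ (List.map (y ∷_) (f y)) p
  ... | inj₁ q with ∈-map⁻ (y ∷_) q
  ...   | _ , v∈ , refl = here refl , v∈
  ∈-consAll⁻ (y ∷ xs) {f} p | inj₂ q with ∈-consAll⁻ xs q
  ...   | x∈ , v∈ = there x∈ , v∈

  consAll-unique : ∀ {xs} {f : A → List (Vec A n)} →
                   Unique xs → (∀ x → Unique (f x)) → Unique (consAll xs f)
  consAll-unique []                   uf = []
  consAll-unique {x ∷ xs} {f} (x∉ ∷ u) uf =
    Unique.++⁺ (Unique.map⁺ Vec.∷-injectiveʳ (uf x)) (consAll-unique u uf) disjoint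
    where
    disjoint : ∀ {v} → ¬ (v ∈ List.map (x ∷_) (f x) × v ∈ consAll xs f)
    disjoint (p , q) with ∈-map⁻ (x ∷_) p
    ... | _ , _ , refl with ∈-consAll⁻ xs q
    ...   | x∈ , _ = All¬⇒¬Any x∉ x∈

∈-compositions⁺ : ∀ {n m} (η : Vec ℕ n) → Vec.sum η ≡ m → η ∈ compositions n m
∈-compositions⁺ []      refl = here refl
∈-compositions⁺ (a ∷ η) refl = ∈-consAll⁺
  (∈-upTo⁺ (s≤s (ℕ.m≤m+n a (Vec.sum η))))
  (∈-compositions⁺ η (sym (ℕ.m+n∸m≡n a (Vec.sum η))))

∈-compositions⁻ : ∀ {n m} (η : Vec ℕ n) → η ∈ compositions n m → Vec.sum η ≡ m
∈-compositions⁻ {m = zero}  [] _ = refl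
∈-compositions⁻ {m = suc m} [] ()
∈-compositions⁻ {m = m} (a ∷ η) p with ∈-consAll⁻ (upTo (suc m)) p
... | a∈ , η∈ = trans (cong (a ℕ.+_) (∈-compositions⁻ η η∈))
                      (ℕ.m+[n∸m]≡n (s≤s⁻¹ (∈-upTo⁻ a∈)))

compositions-unique : ∀ n m → Unique (compositions n m)
compositions-unique zero    zero    = ListAll.[] ∷ []
compositions-unique zero    (suc m) = []
compositions-unique (suc n) m       =
  consAll-unique (Unique.upTo⁺ (suc m)) (λ a → compositions-unique n (m ∸ a))

∈-configs⁺ : ∀ {n k} {m : Vec ℕ k} (w : Config n k) →
             Vec.map Vec.sum w ≡ m → w ∈ configs n m
∈-configs⁺ []      refl = here refl
∈-configs⁺ (η ∷ w) refl = ∈-consAll⁺ (∈-compositions⁺ η refl) (∈-configs⁺ w refl)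

∈-configs⁻ : ∀ {n k} {m : Vec ℕ k} (w : Config n k) →
             w ∈ configs n m → Vec.map Vec.sum w ≡ m
∈-configs⁻ {m = []}     []      _ = refl
∈-configs⁻ {m = m ∷ ms} (η ∷ w) p with ∈-consAll⁻ (compositions _ m) p
... | η∈ , w∈ = cong₂ _∷_ (∈-compositions⁻ η η∈) (∈-configs⁻ w w∈)

configs-unique : ∀ n {k} (m : Vec ℕ k) → Unique (configs n m)
configs-unique n []       = ListAll.[] ∷ []
configs-unique n (m ∷ ms) = consAll-unique (compositions-unique n m) (λ _ → configs-unique n ms)

-- sumFrom i (v₀,…,vₖ₋₁) = vᵢ + ⋯ + vₖ₋₁.  Because of the shift in the
-- numbering of species, Mⱼ is sumFrom (j - 1) m.
sumFrom : ∀ {k} → ℕ → Vec ℕ k → ℕ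
sumFrom i v = List.sum (List.drop i (toList v))

next : ∀ {n} → Fin (suc n) → Fin (suc n)
next {n} s = suc (toℕ s) mod suc n

module _ {n k : ℕ} where

  count : Config n k → Fin k → Fin n → ℕ
  count w r s = lookup (lookup w r) s

  countAbove : Config n k → Fin k → Fin n → ℕ
  countAbove w r s = sumFrom (suc (toℕ r)) (Vec.map (λ row → lookup row s) w)

-- A particle of species r moves from site s to the next one.  This is only
-- meaningful if there is such a particle; otherwise the rate below is [0]ₜ = 0.
jump : ∀ {n k} → Config (suc n) k → Fin k → Fin (suc n) → Config (suc n) k
jump w r s = updateAt w r (λ row → updateAt (updateAt row s pred) (next s) suc)

module MTAZRP {c ℓ₁ ℓ₂} (F : OrderedField c ℓ₁ ℓ₂) where
  open OrderedField F

  sumOver : ∀ {a} {A : Set a} → List A → (A → Carrier) → Carrier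
  sumOver as f = List.foldr (λ a acc → f a + acc) 0# as

  syntax sumOver as (λ a → e) = ∑[ a ∈ as ] e

  -- π is a stationary distribution of the continuous-time chain on the given
  -- finite set of states with transition rates q.  Diagonal rates q w w, which
  -- occur for the ring with one site, cancel from the balance equation.
  record IsStationary {a} {A : Set a} (states : List A) (q : A → A → Carrier)
                      (π : A → Carrier) : Set (a ⊔ ℓ₁ ⊔ ℓ₂) where
    field
      nonNegative : ∀ {w} → w ∈ states → 0# ≤ π w
      total       : (∑[ w ∈ states ] π w) ≈ 1#
      balance     : ∀ {w} → w ∈ states →
                    (∑[ v ∈ states ] (π v * q v w)) ≈ (∑[ v ∈ states ] (π w * q w v))

  [_]⟨_⟩ : ℕ → Carrier → Carrier
  [ zero  ]⟨ t ⟩ = 0#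
  [ suc a ]⟨ t ⟩ = [ a ]⟨ t ⟩ + t ^ a

  [_]!⟨_⟩ : ℕ → Carrier → Carrier
  [ zero  ]!⟨ t ⟩ = 1#
  [ suc a ]!⟨ t ⟩ = [ a ]!⟨ t ⟩ * [ suc a ]⟨ t ⟩

  multinomial : ∀ {n} → Carrier → ℕ → Vec ℕ n → Carrier
  multinomial t m η = [ m ]!⟨ t ⟩ / product (λ i → [ lookup η i ]!⟨ t ⟩)

  -- The modified Macdonald polynomial H̃ of ⟨1ᵐ⟩ at (x₁,…,xₙ; 1, t).
  H̃ : ∀ {n} → Vector Carrier n → Carrier → ℕ → Carrier
  H̃ {n} x t m = ∑[ η ∈ compositions n m ] (multinomial t m η * product (λ i → x i ^ lookup η i))

  rate : ∀ {n k} → Vector Carrier n → Carrier → Config n k → Fin k → Fin n → Carrier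
  rate x t w r s = x s ⁻¹ * t ^ countAbove w r s * [ count w r s ]⟨ t ⟩

  transition : ∀ {n k} → Vector Carrier (suc n) → Carrier →
               Config (suc n) k → Config (suc n) k → Carrier
  transition x t w w′ = sum λ s → sum λ r →
    if does (jump w r s ≟ᶜ w′) then rate x t w r s else 0#

  IsStationaryMTAZRP : ∀ {n k} → Vector Carrier (suc n) → Carrier → Vec ℕ k →
                       (Config (suc n) k → Carrier) → Set (ℓ₁ ⊔ ℓ₂)
  IsStationaryMTAZRP {n} x t m = IsStationary (configs (suc n) m) (transition x t)

  current : ∀ {n k} → Vector Carrier (suc n) → Carrier → Vec ℕ k →
            (Config (suc n) k → Carrier) → Fin k → Carrier
  current {n} x t m π j = ∑[ w ∈ configs (suc n) m ] (π w * rate x t w j zero)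

  -- [M]ₜ H̃⟨1^(M-1)⟩ / H̃⟨1^M⟩, which is 0 for M = 0.
  currentTerm : ∀ {n} → Vector Carrier n → Carrier → ℕ → Carrier
  currentTerm x t zero    = 0#
  currentTerm x t (suc M) = [ suc M ]⟨ t ⟩ * (H̃ x t M / H̃ x t (suc M))

{-# OPTIONS --safe #-}
module Submission where

-- Species j, …, k together do not see the smaller ones and, since
-- [d + c]ₜ = [d]ₜ + tᵈ [c]ₜ, their total jump rate from a site with a of them is
-- x⁻¹ [a]ₜ: merged into one species they form a zero range process of Mⱼ
-- particles.  The current of species j is thus the difference of two
-- single-species currents.  The single-species process is stationary for the
-- product weight ∏ xᵢ^ηᵢ / [ηᵢ]ₜ!, because removing a particle from site s turns
-- weight times departure rate into the weight of the smaller configuration.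
-- Uniqueness: let h be the density of a stationary distribution with respect to
-- this weight.  Testing the balance equation against h itself gives
-- ∑ weight(ξ) (h(ξ + e_s) - h(ξ + e_{s+1}))² = 0, the sum running over s and the
-- configurations ξ with one particle less, so h is constant.

open import Defs
open import Algebra.Bundles using (CommutativeRing)
open import Data.Bool.Base using (if_then_else_; true; false)
open import Data.Fin.Base using (Fin; zero; suc; toℕ; inject₁; fromℕ)
open import Data.Fin.Induction using (<-weakInduction)
import Data.Fin.Properties as Fin
open import Data.List.Base using (List; []; _∷_)
open import Data.List.Membership.Propositional using (_∈_)
open import Data.List.Relation.Unary.All as ListAll using ()
open import Data.List.Relation.Unary.Any using (here; there)
open import Data.List.Relation.Unary.Unique.Propositional using (Unique; []; _∷_)
open import Data.Nat.Base as ℕ using (ℕ; zero; suc; pred)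
open import Data.Nat.DivMod using (m<n⇒m%n≡m; n%n≡0)
import Data.Nat.Properties as ℕ
open import Data.Nat.Solver using (module +-*-Solver)
open import Data.Product.Base using (_×_; _,_; ∃; proj₁; proj₂)
open import Data.Sum.Base using (inj₁; inj₂)
open import Data.Vec.Base as Vec using (Vec; []; _∷_; lookup; updateAt; replicate; zipWith)
open import Data.Vec.Functional using (Vector)
import Data.Vec.Properties as Vec
open import Data.Vec.Relation.Unary.All using (All)
open import Function.Base using (_∘_)
open import Function.Bundles using (mk⇔)
open import Relation.Binary.Definitions using (DecidableEquality; tri<; tri≈; tri>)
open import Relation.Binary.PropositionalEquality as ≡ using (_≡_; _≢_; cong; cong₂)
open import Relation.Binary.Structures using (IsStrictTotalOrder)
open import Relation.Nullary.Decidable using (does; dec-true; dec-false; does-⇔)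
open import Relation.Nullary.Negation using (¬_; contradiction)

-- Occupation vectors and the ring: adding, removing and moving particles.

add : ∀ {n} → Vec ℕ n → Fin n → Vec ℕ n
add η s = updateAt η s suc

hop : ∀ {n} → Vec ℕ (suc n) → Fin (suc n) → Vec ℕ (suc n)
hop η s = add (updateAt η s pred) (next s)

remove-add : ∀ {n} (η : Vec ℕ n) s → updateAt (add η s) s pred ≡ η
remove-add η s = ≡.trans (Vec.updateAt-updateAt s η) (Vec.updateAt-id s η)

-- A particle at `s` is required: at an empty site `pred` does nothing and `add` would create one.
add-remove : ∀ {n} (η : Vec ℕ n) s {c} → lookup η s ≡ suc c → add (updateAt η s pred) s ≡ η
add-remove η s eq = ≡.trans (Vec.updateAt-updateAt s η)
  (Vec.updateAt-id-local s η (≡.trans (cong (λ a → suc (pred a)) eq) (≡.sym eq)))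

add-injective : ∀ {n} {η θ : Vec ℕ n} s → add η s ≡ add θ s → η ≡ θ
add-injective {η = η} {θ} s eq =
  ≡.trans (≡.sym (remove-add η s)) (≡.trans (cong (λ ζ → updateAt ζ s pred) eq) (remove-add θ s))

sum-add : ∀ {n} (η : Vec ℕ n) s → Vec.sum (add η s) ≡ suc (Vec.sum η)
sum-add (a ∷ η) zero    = ≡.refl
sum-add (a ∷ η) (suc s) = ≡.trans (cong (a ℕ.+_) (sum-add η s)) (ℕ.+-suc a (Vec.sum η))

-- Describes a move by the particles `ξ` that stay behind. Start and end then have the same form,
-- `add ξ` at two neighbouring sites, which the energy argument relies on.
hop-add : ∀ {n} (ξ : Vec ℕ (suc n)) s → hop (add ξ s) s ≡ add ξ (next s)
hop-add ξ s = cong (λ ζ → add ζ (next s)) (remove-add ξ s)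

sum-hop : ∀ {n} (η : Vec ℕ (suc n)) s {c} → lookup η s ≡ suc c → Vec.sum (hop η s) ≡ Vec.sum η
sum-hop η s eq = begin
  Vec.sum (hop η s)                 ≡⟨ sum-add (updateAt η s pred) (next s) ⟩
  suc (Vec.sum (updateAt η s pred)) ≡⟨ sum-add (updateAt η s pred) s ⟨
  Vec.sum (add (updateAt η s pred) s) ≡⟨ cong Vec.sum (add-remove η s eq) ⟩
  Vec.sum η                         ∎
  where open ≡.≡-Reasoning

zipWith-add : ∀ {n} (ζ η : Vec ℕ n) s → zipWith ℕ._+_ (add ζ s) η ≡ add (zipWith ℕ._+_ ζ η) s
zipWith-add (a ∷ ζ) (b ∷ η) zero    = ≡.refl
zipWith-add (a ∷ ζ) (b ∷ η) (suc s) = cong (_ ∷_) (zipWith-add ζ η s)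

-- Only for a site with a particle, because of the truncated predecessor.
zipWith-hop : ∀ {n} (ζ η : Vec ℕ (suc n)) s {c} → lookup ζ s ≡ suc c →
              zipWith ℕ._+_ (hop ζ s) η ≡ hop (zipWith ℕ._+_ ζ η) s
zipWith-hop ζ η s eq = begin
  zipWith ℕ._+_ (hop ζ s) η         ≡⟨ zipWith-add ζ⁻ η (next s) ⟩
  add (zipWith ℕ._+_ ζ⁻ η) (next s) ≡⟨ hop-add (zipWith ℕ._+_ ζ⁻ η) s ⟨
  hop (add (zipWith ℕ._+_ ζ⁻ η) s) s ≡⟨ cong (λ θ → hop θ s) (zipWith-add ζ⁻ η s) ⟨
  hop (zipWith ℕ._+_ (add ζ⁻ s) η) s ≡⟨ cong (λ θ → hop (zipWith ℕ._+_ θ η) s) (add-remove ζ s eq) ⟩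
  hop (zipWith ℕ._+_ ζ η) s         ∎
  where
  open ≡.≡-Reasoning
  ζ⁻ = updateAt ζ s pred

-- The remainder in `next` wraps around at the last site only; with `next-fromℕ` this gives both
-- cases of the cyclic shift.
next-inject₁ : ∀ {n} (i : Fin n) → next (inject₁ i) ≡ suc i
next-inject₁ {n} i = Fin.toℕ-injective (begin
  toℕ (next (inject₁ i))          ≡⟨ Fin.toℕ-fromℕ< _ ⟩
  suc (toℕ (inject₁ i)) ℕ.% suc n ≡⟨ cong (λ a → suc a ℕ.% suc n) (Fin.toℕ-inject₁ i) ⟩
  suc (toℕ i) ℕ.% suc n           ≡⟨ m<n⇒m%n≡m (ℕ.s<s (Fin.toℕ<n i)) ⟩
  suc (toℕ i)                     ∎)
  where open ≡.≡-Reasoning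

next-fromℕ : ∀ n → next (fromℕ n) ≡ zero
next-fromℕ n = Fin.toℕ-injective (begin
  toℕ (next (fromℕ n))          ≡⟨ Fin.toℕ-fromℕ< _ ⟩
  suc (toℕ (fromℕ n)) ℕ.% suc n ≡⟨ cong (λ a → suc a ℕ.% suc n) (Fin.toℕ-fromℕ n) ⟩
  suc n ℕ.% suc n               ≡⟨ n%n≡0 (suc n) ⟩
  zero                          ∎)
  where open ≡.≡-Reasoning

sum≡0⇒replicate : ∀ {n} (η : Vec ℕ n) → Vec.sum η ≡ 0 → η ≡ replicate n 0
sum≡0⇒replicate []         _  = ≡.refl
sum≡0⇒replicate (zero ∷ η) eq = cong (0 ∷_) (sum≡0⇒replicate η eq)

sum≡suc⇒add : ∀ {n p} (η : Vec ℕ n) → Vec.sum η ≡ suc p → ∃ λ ξ → ∃ λ s → η ≡ add ξ s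
sum≡suc⇒add (suc a ∷ η) _  = a ∷ η , zero , ≡.refl
sum≡suc⇒add (zero ∷ η)  eq with sum≡suc⇒add η eq
... | ξ , s , eq′ = zero ∷ ξ , suc s , cong (0 ∷_) eq′

-- Merging species.

-- Forget the species below the i-th (counted from zero) and identify the
-- remaining ones.
merge : ∀ {n k} → ℕ → Config n k → Vec ℕ n
merge i       []        = replicate _ 0
merge zero    (row ∷ w) = zipWith ℕ._+_ row (merge zero w)
merge (suc i) (row ∷ w) = merge i w

-- Links `merge` to the rates: for `i = suc (toℕ r)` the right-hand side is `countAbove w r s`.
lookup-merge : ∀ {n k} i (w : Config n k) s →
               lookup (merge i w) s ≡ sumFrom i (Vec.map (λ row → lookup row s) w)
lookup-merge zero    []        s = Vec.lookup-replicate s 0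
lookup-merge (suc i) []        s = Vec.lookup-replicate s 0
lookup-merge zero    (row ∷ w) s = ≡.trans (Vec.lookup-zipWith ℕ._+_ s row (merge zero w))
                                           (cong (lookup row s ℕ.+_) (lookup-merge zero w s))
lookup-merge (suc i) (row ∷ w) s = lookup-merge i w s

sum-replicate-0 : ∀ n → Vec.sum (replicate n 0) ≡ 0
sum-replicate-0 zero    = ≡.refl
sum-replicate-0 (suc n) = sum-replicate-0 n

sum-zipWith-+ : ∀ {n} (ζ η : Vec ℕ n) → Vec.sum (zipWith ℕ._+_ ζ η) ≡ Vec.sum ζ ℕ.+ Vec.sum η
sum-zipWith-+ []      []      = ≡.refl
sum-zipWith-+ (a ∷ ζ) (b ∷ η) = begin
  a ℕ.+ b ℕ.+ Vec.sum (zipWith ℕ._+_ ζ η)   ≡⟨ cong (a ℕ.+ b ℕ.+_) (sum-zipWith-+ ζ η) ⟩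
  a ℕ.+ b ℕ.+ (Vec.sum ζ ℕ.+ Vec.sum η)     ≡⟨ solve 4 (λ a b c d → a :+ b :+ (c :+ d) := a :+ c :+ (b :+ d))
                                                     ≡.refl a b (Vec.sum ζ) (Vec.sum η) ⟩
  a ℕ.+ Vec.sum ζ ℕ.+ (b ℕ.+ Vec.sum η)     ∎
  where
  open ≡.≡-Reasoning
  open +-*-Solver

sum-merge : ∀ {n k} i (w : Config n k) → Vec.sum (merge i w) ≡ sumFrom i (Vec.map Vec.sum w)
sum-merge {n} zero    []        = sum-replicate-0 n
sum-merge {n} (suc i) []        = sum-replicate-0 n
sum-merge     zero    (row ∷ w) = ≡.trans (sum-zipWith-+ row (merge zero w))
                                          (cong (Vec.sum row ℕ.+_) (sum-merge zero w))
sum-merge     (suc i) (row ∷ w) = sum-merge i w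

sum≡0⇒lookup≡0 : ∀ {n} (η : Vec ℕ n) s → Vec.sum η ≡ 0 → lookup η s ≡ 0
sum≡0⇒lookup≡0 η s eq = ≡.trans (cong (λ θ → lookup θ s) (sum≡0⇒replicate η eq)) (Vec.lookup-replicate s 0)

-- Keeps jumps inside the state space. The particle is essential, since a jump from an empty site
-- would increase the number of particles.
map-sum-jump : ∀ {n k} (w : Config (suc n) k) r s {c} → count w r s ≡ suc c →
               Vec.map Vec.sum (jump w r s) ≡ Vec.map Vec.sum w
map-sum-jump (row ∷ w) zero    s eq = cong (_∷ _) (sum-hop row s eq)
map-sum-jump (row ∷ w) (suc r) s eq = cong (_ ∷_) (map-sum-jump w r s eq)

-- The larger species come first in the sum, matching the order `d ℕ.+ a` in `[]-+`.
sumFrom-suc : ∀ {k} (v : Vec ℕ k) j → sumFrom (toℕ j) v ≡ sumFrom (suc (toℕ j)) v ℕ.+ lookup v j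
sumFrom-suc (a ∷ v) zero    = ℕ.+-comm a _
sumFrom-suc (a ∷ v) (suc j) = sumFrom-suc v j

-- Ordered field arithmetic, finite sums and products.

module OrderedFieldProperties {c ℓ₁ ℓ₂} (F : OrderedField c ℓ₁ ℓ₂) where
  open OrderedField F
  open MTAZRP F
  open CommutativeRing commutativeRing public
    using ( setoid; refl; sym; trans; reflexive; +-cong; +-congˡ; +-congʳ; *-cong; *-congˡ; *-congʳ
          ; +-identityˡ; +-identityʳ; *-identityˡ; *-identityʳ; +-assoc; +-comm; *-assoc; *-comm
          ; zeroˡ; zeroʳ; distribˡ; distribʳ; -‿cong; -‿inverseˡ; -‿inverseʳ
          ; semiring; commutativeSemiring; ring; *-commutativeMonoid; +-group)
  open import Algebra.Properties.Ring ring public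
    using (-‿distribˡ-*; -‿distribʳ-*)
  open import Algebra.Properties.Group +-group public
    using () renaming (∙-cancelˡ to +-cancelˡ; ∙-cancelʳ to +-cancelʳ; ⁻¹-involutive to -‿involutive)
  open import Algebra.Properties.Semiring.Sum semiring public
    using (sum-cong-≋; sum-replicate-zero; sum-init-last; ∑-distrib-+; *-distribˡ-sum; *-distribʳ-sum)
  open import Algebra.Properties.CommutativeMonoid.Sum *-commutativeMonoid public
    using () renaming (∑-distrib-+ to ∏-distrib-*)
  open import Algebra.Solver.Ring.NaturalCoefficients.Default commutativeSemiring public
    using (solve; _:=_; _:+_; _:*_)
  open import Relation.Binary.Reasoning.Setoid setoid
  open IsStrictTotalOrder isStrictTotalOrder public
    using (compare; irrefl; <-resp-≈)
    renaming (trans to <-trans)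

  >⇒≉ : ∀ {x} → 0# < x → ¬ (x ≈ 0#)
  >⇒≉ 0<x x≈0 = irrefl (sym x≈0) 0<x

  <0⇒0<- : ∀ {x} → x < 0# → 0# < - x
  <0⇒0<- {x} x<0 = <-resp-≈ .proj₁ (+-identityˡ (- x)) (<-resp-≈ .proj₂ (-‿inverseʳ x) (+-monoˡ-< (- x) x<0))

  -x*-x≈x*x : ∀ x → - x * - x ≈ x * x
  -x*-x≈x*x x = begin
    - x * - x     ≈⟨ -‿distribˡ-* x (- x) ⟨
    - (x * - x)   ≈⟨ -‿cong (-‿distribʳ-* x x) ⟨
    - - (x * x)   ≈⟨ -‿involutive (x * x) ⟩
    x * x         ∎

  square-pos : ∀ {x} → ¬ (x ≈ 0#) → 0# < x * x
  square-pos {x} x≉0 with compare x 0#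
  ... | tri< x<0 _ _ = <-resp-≈ .proj₁ (-x*-x≈x*x x) (*-pos (<0⇒0<- x<0) (<0⇒0<- x<0))
  ... | tri≈ _ x≈0 _ = contradiction x≈0 x≉0
  ... | tri> _ _ 0<x = *-pos 0<x 0<x

  0<1 : 0# < 1#
  0<1 = <-resp-≈ .proj₁ (*-identityʳ 1#) (square-pos (0≉1 ∘ sym))

  square-nonNeg : ∀ x → 0# ≤ x * x
  square-nonNeg x with compare x 0#
  ... | tri< _ x≉0 _ = inj₁ (square-pos x≉0)
  ... | tri≈ _ x≈0 _ = inj₂ (sym (trans (*-congˡ x≈0) (zeroʳ x)))
  ... | tri> _ x≉0 _ = inj₁ (square-pos x≉0)

  square≈0⇒≈0 : ∀ {x} → x * x ≈ 0# → x ≈ 0#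
  square≈0⇒≈0 {x} eq with compare x 0#
  ... | tri< _ x≉0 _ = contradiction eq (>⇒≉ (square-pos x≉0))
  ... | tri≈ _ x≈0 _ = x≈0
  ... | tri> _ x≉0 _ = contradiction eq (>⇒≉ (square-pos x≉0))

  *-nonNeg : ∀ {x y} → 0# < x → 0# ≤ y → 0# ≤ x * y
  *-nonNeg 0<x (inj₁ 0<y) = inj₁ (*-pos 0<x 0<y)
  *-nonNeg 0<x (inj₂ 0≈y) = inj₂ (sym (trans (*-congˡ (sym 0≈y)) (zeroʳ _)))

  +-pos-nonNeg : ∀ {x y} → 0# < x → 0# ≤ y → 0# < x + y
  +-pos-nonNeg {x} {y} 0<x (inj₁ 0<y) =
    <-trans 0<y (<-resp-≈ .proj₂ (+-identityˡ y) (+-monoˡ-< y 0<x))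
  +-pos-nonNeg 0<x (inj₂ 0≈y) =
    <-resp-≈ .proj₁ (trans (sym (+-identityʳ _)) (+-congˡ 0≈y)) 0<x

  +-nonNeg-pos : ∀ {x y} → 0# ≤ x → 0# < y → 0# < x + y
  +-nonNeg-pos 0≤x 0<y = <-resp-≈ .proj₁ (+-comm _ _) (+-pos-nonNeg 0<y 0≤x)

  +-nonNeg : ∀ {x y} → 0# ≤ x → 0# ≤ y → 0# ≤ x + y
  +-nonNeg (inj₁ 0<x) 0≤y = inj₁ (+-pos-nonNeg 0<x 0≤y)
  +-nonNeg (inj₂ 0≈x) (inj₁ 0<y) = inj₁ (+-nonNeg-pos (inj₂ 0≈x) 0<y)
  +-nonNeg (inj₂ 0≈x) (inj₂ 0≈y) = inj₂ (trans (sym (+-identityʳ 0#)) (+-cong 0≈x 0≈y))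

  +-nonNeg-≈0 : ∀ {x y} → 0# ≤ x → 0# ≤ y → x + y ≈ 0# → x ≈ 0# × y ≈ 0#
  +-nonNeg-≈0 (inj₁ 0<x) 0≤y eq = contradiction eq (>⇒≉ (+-pos-nonNeg 0<x 0≤y))
  +-nonNeg-≈0 0≤x@(inj₂ _) (inj₁ 0<y) eq = contradiction eq (>⇒≉ (+-nonNeg-pos 0≤x 0<y))
  +-nonNeg-≈0 (inj₂ 0≈x) (inj₂ 0≈y) eq = sym 0≈x , sym 0≈y

  x*y≈0⇒y≈0 : ∀ {x y} → ¬ (x ≈ 0#) → x * y ≈ 0# → y ≈ 0#
  x*y≈0⇒y≈0 {x} {y} x≉0 eq = begin
    y                ≈⟨ *-identityˡ y ⟨
    1# * y           ≈⟨ *-congʳ (*-inverseʳ x≉0) ⟨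
    x * x ⁻¹ * y     ≈⟨ solve 3 (λ x z y → x :* z :* y := z :* (x :* y)) refl x (x ⁻¹) y ⟩
    x ⁻¹ * (x * y)   ≈⟨ *-congˡ eq ⟩
    x ⁻¹ * 0#        ≈⟨ zeroʳ (x ⁻¹) ⟩
    0#               ∎

  x*y≈z⇒y≈z/x : ∀ {x y z} → ¬ (x ≈ 0#) → x * y ≈ z → y ≈ z / x
  x*y≈z⇒y≈z/x {x} {y} {z} x≉0 eq = begin
    y                ≈⟨ *-identityˡ y ⟨
    1# * y           ≈⟨ *-congʳ (*-inverseʳ x≉0) ⟨
    x * x ⁻¹ * y     ≈⟨ solve 3 (λ x z y → x :* z :* y := x :* y :* z) refl x (x ⁻¹) y ⟩
    x * y * x ⁻¹     ≈⟨ *-congʳ eq ⟩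
    z * x ⁻¹         ∎

  ⁻¹-pos : ∀ {x} → 0# < x → 0# < x ⁻¹
  ⁻¹-pos {x} 0<x with compare (x ⁻¹) 0#
  ... | tri> _ _ 0<x⁻¹ = 0<x⁻¹
  ... | tri≈ _ x⁻¹≈0 _ = contradiction
    (trans (sym (zeroʳ x)) (trans (*-congˡ (sym x⁻¹≈0)) (*-inverseʳ (>⇒≉ 0<x)))) 0≉1
  -- If `x ⁻¹` were negative, then `- 1#`, being `x * - (x ⁻¹)`, would be positive, and so would
  -- `- 1# + 1#`.
  ... | tri< x⁻¹<0 _ _ = contradiction (-‿inverseˡ 1#) (>⇒≉ (+-pos-nonNeg 0<-1 (inj₁ 0<1)))
    where
    0<-1 : 0# < - 1#
    0<-1 = <-resp-≈ .proj₁
      (trans (sym (-‿distribʳ-* x (x ⁻¹)))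
             (-‿cong (*-inverseʳ (>⇒≉ 0<x))))
      (*-pos 0<x (<0⇒0<- x⁻¹<0))

  ^-pos : ∀ {x} a → 0# < x → 0# < x ^ a
  ^-pos zero    0<x = 0<1
  ^-pos (suc a) 0<x = *-pos 0<x (^-pos a 0<x)

  product-pos : ∀ {n} (f : Vector Carrier n) → (∀ i → 0# < f i) → 0# < product f
  product-pos {zero}  f 0<f = 0<1
  product-pos {suc n} f 0<f = *-pos (0<f zero) (product-pos (f ∘ suc) (0<f ∘ suc))

  product-cong : ∀ {n} {f g : Vector Carrier n} → (∀ i → f i ≈ g i) → product f ≈ product g
  product-cong {zero}  eq = refl
  product-cong {suc n} eq = *-cong (eq zero) (product-cong (eq ∘ suc))

  product-1 : ∀ n → product {n} (λ _ → 1#) ≈ 1#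
  product-1 zero    = refl
  product-1 (suc n) = trans (*-identityˡ _) (product-1 n)

  -- By uniqueness of inverses; positivity keeps every factor away from 0, where `⁻¹` is
  -- unspecified.
  product-⁻¹ : ∀ {n} (f : Vector Carrier n) → (∀ i → 0# < f i) →
               product (λ i → f i ⁻¹) ≈ product f ⁻¹
  product-⁻¹ {n} f 0<f = trans (x*y≈z⇒y≈z/x (>⇒≉ (product-pos f 0<f)) (begin
    product f * product (λ i → f i ⁻¹)  ≈⟨ ∏-distrib-* f (λ i → f i ⁻¹) ⟨
    product (λ i → f i * f i ⁻¹)        ≈⟨ product-cong (λ i → *-inverseʳ (>⇒≉ (0<f i))) ⟩
    product {n} (λ _ → 1#)              ≈⟨ product-1 n ⟩
    1#                                  ∎)) (*-identityˡ _)

  sum-nonNeg : ∀ {n} (f : Vector Carrier n) → (∀ i → 0# ≤ f i) → 0# ≤ sum f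
  sum-nonNeg {zero}  f 0≤f = inj₂ refl
  sum-nonNeg {suc n} f 0≤f = +-nonNeg (0≤f zero) (sum-nonNeg (f ∘ suc) (0≤f ∘ suc))

  sum-nonNeg-≈0 : ∀ {n} (f : Vector Carrier n) → (∀ i → 0# ≤ f i) → sum f ≈ 0# → ∀ i → f i ≈ 0#
  sum-nonNeg-≈0 {suc n} f 0≤f eq i
    with +-nonNeg-≈0 (0≤f zero) (sum-nonNeg (f ∘ suc) (0≤f ∘ suc)) eq | i
  ... | f₀≈0 , _ | zero   = f₀≈0
  ... | _ , rest | suc i′ = sum-nonNeg-≈0 (f ∘ suc) (0≤f ∘ suc) rest i′

  -- Splitting off the last site, which `next` sends to `zero`, leaves the sites that it sends to
  -- `suc i`.
  sum-next : ∀ {n} (f : Vector Carrier (suc n)) → sum (f ∘ next) ≈ sum f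
  sum-next {n} f = begin
    sum (f ∘ next)                                  ≈⟨ sum-init-last (f ∘ next) ⟩
    sum (f ∘ next ∘ inject₁) + f (next (fromℕ n))   ≈⟨ +-cong (sum-cong-≋ (λ i → reflexive (cong f (next-inject₁ i))))
                                                              (reflexive (cong f (next-fromℕ n))) ⟩
    sum (f ∘ suc) + f zero                          ≈⟨ +-comm _ _ ⟩
    f zero + sum (f ∘ suc)                          ∎

  -- Sums over lists and indicator functions.

  module _ {a} {A : Set a} where

    sumOver-cong : ∀ (as : List A) {f g : A → Carrier} → (∀ {b} → b ∈ as → f b ≈ g b) →
                   sumOver as f ≈ sumOver as g
    sumOver-cong []       eq = refl
    sumOver-cong (b ∷ as) eq = +-cong (eq (here ≡.refl)) (sumOver-cong as (eq ∘ there))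

    sumOver-zero : ∀ (as : List A) {f : A → Carrier} → (∀ {b} → b ∈ as → f b ≈ 0#) → sumOver as f ≈ 0#
    sumOver-zero []       eq = refl
    sumOver-zero (b ∷ as) eq =
      trans (+-cong (eq (here ≡.refl)) (sumOver-zero as (eq ∘ there))) (+-identityˡ 0#)

    sumOver-+ : ∀ (as : List A) (f g : A → Carrier) →
                (∑[ b ∈ as ] (f b + g b)) ≈ sumOver as f + sumOver as g
    sumOver-+ []       f g = sym (+-identityˡ 0#)
    sumOver-+ (b ∷ as) f g = trans (+-congˡ (sumOver-+ as f g))
      (solve 4 (λ x y z w → x :+ y :+ (z :+ w) := x :+ z :+ (y :+ w)) refl _ _ _ _)

    *-distribˡ-sumOver : ∀ (as : List A) y (f : A → Carrier) → y * sumOver as f ≈ (∑[ b ∈ as ] (y * f b))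
    *-distribˡ-sumOver []       y f = zeroʳ y
    *-distribˡ-sumOver (b ∷ as) y f = trans (distribˡ _ _ _) (+-congˡ (*-distribˡ-sumOver as y f))

    *-distribʳ-sumOver : ∀ (as : List A) y (f : A → Carrier) → sumOver as f * y ≈ (∑[ b ∈ as ] (f b * y))
    *-distribʳ-sumOver []       y f = zeroˡ y
    *-distribʳ-sumOver (b ∷ as) y f = trans (distribʳ _ _ _) (+-congˡ (*-distribʳ-sumOver as y f))

    sumOver-sum-swap : ∀ (as : List A) {n} (f : A → Vector Carrier n) →
                       (∑[ b ∈ as ] sum (f b)) ≈ sum (λ i → ∑[ b ∈ as ] f b i)
    sumOver-sum-swap []       {n} f = sym (sum-replicate-zero n)
    sumOver-sum-swap (b ∷ as) f = trans (+-congˡ (sumOver-sum-swap as f)) (sym (∑-distrib-+ (f b) _))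

    sumOver-swap : ∀ {b} {B : Set b} (as : List A) (bs : List B) (f : A → B → Carrier) →
                   (∑[ x ∈ as ] ∑[ y ∈ bs ] f x y) ≈ (∑[ y ∈ bs ] ∑[ x ∈ as ] f x y)
    sumOver-swap []       bs f = sym (zeros bs)
      where
      zeros : ∀ {b} {B : Set b} (bs : List B) → (∑[ y ∈ bs ] 0#) ≈ 0#
      zeros []       = refl
      zeros (_ ∷ bs) = trans (+-identityˡ _) (zeros bs)
    sumOver-swap (x ∷ as) bs f = trans (+-congˡ (sumOver-swap as bs f)) (sym (plus bs))
      where
      plus : ∀ bs → (∑[ y ∈ bs ] (f x y + (∑[ x ∈ as ] f x y))) ≈ sumOver bs (f x) + (∑[ y ∈ bs ] ∑[ x ∈ as ] f x y)
      plus []       = sym (+-identityˡ 0#)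
      plus (y ∷ bs) = trans (+-congˡ (plus bs))
        (solve 4 (λ x y z w → x :+ y :+ (z :+ w) := x :+ z :+ (y :+ w)) refl _ _ _ _)

    sumOver-nonNeg : ∀ (as : List A) {f : A → Carrier} → (∀ {b} → b ∈ as → 0# ≤ f b) → 0# ≤ sumOver as f
    sumOver-nonNeg []       0≤f = inj₂ refl
    sumOver-nonNeg (b ∷ as) 0≤f = +-nonNeg (0≤f (here ≡.refl)) (sumOver-nonNeg as (0≤f ∘ there))

    sumOver-nonNeg-≈0 : ∀ (as : List A) {f : A → Carrier} → (∀ {b} → b ∈ as → 0# ≤ f b) →
                        sumOver as f ≈ 0# → ∀ {b} → b ∈ as → f b ≈ 0#
    sumOver-nonNeg-≈0 (b ∷ as) 0≤f eq b∈
      with +-nonNeg-≈0 (0≤f (here ≡.refl)) (sumOver-nonNeg as (0≤f ∘ there)) eq | b∈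
    ... | f₀≈0 , _ | here ≡.refl = f₀≈0
    ... | _ , rest | there b∈′   = sumOver-nonNeg-≈0 as (0≤f ∘ there) rest b∈′

    module _ (_≟_ : DecidableEquality A) where

      -- Has the shape of the summands of `transition`, which are therefore instances of it by
      -- definition.
      δ : A → Carrier → A → Carrier
      δ a y b = if does (a ≟ b) then y else 0#

      -- Discards a jump of rate 0 without deciding where it lands.
      δ-zero : ∀ {a y} b → y ≈ 0# → δ a y b ≈ 0#
      δ-zero {a} b y≈0 with does (a ≟ b)
      ... | true  = y≈0
      ... | false = refl

      δ-≢ : ∀ {a y b} → a ≢ b → δ a y b ≈ 0#
      δ-≢ {a} {y} {b} a≢b rewrite dec-false (a ≟ b) a≢b = refl

      δ-≡ : ∀ a y → δ a y a ≈ y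
      δ-≡ a y rewrite dec-true (a ≟ a) ≡.refl = refl

      -- Membership makes `a` occur at least once and `Unique` at most once, so exactly one summand
      -- survives.
      sumOver-δ : ∀ {as a} y (f : A → Carrier) → Unique as → a ∈ as →
                  (∑[ b ∈ as ] (δ a y b * f b)) ≈ y * f a
      sumOver-δ {a ∷ as} y f (a∉ ∷ u) (here ≡.refl) = begin
        δ a y a * f a + (∑[ b ∈ as ] (δ a y b * f b))  ≈⟨ +-cong (*-congʳ (δ-≡ a y)) (sumOver-zero as (λ b∈ →
                                                          trans (*-congʳ (δ-≢ (ListAll.lookup a∉ b∈))) (zeroˡ _))) ⟩
        y * f a + 0#                                   ≈⟨ +-identityʳ _ ⟩
        y * f a                                        ∎
      sumOver-δ {b ∷ as} {a} y f (b∉ ∷ u) (there a∈) = begin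
        δ a y b * f b + (∑[ b ∈ as ] (δ a y b * f b))  ≈⟨ +-cong
                                                          (trans (*-congʳ (δ-≢ (ListAll.lookup b∉ a∈ ∘ ≡.sym))) (zeroˡ _))
                                                          (sumOver-δ y f u a∈) ⟩
        0# + y * f a                                   ≈⟨ +-identityˡ _ ⟩
        y * f a                                        ∎

-- The single-species zero range process and its product weight.

module ZeroRangeProcess {c ℓ₁ ℓ₂} (F : OrderedField c ℓ₁ ℓ₂)
                         (t : OrderedField.Carrier F) (0<t : OrderedField._<_ F (OrderedField.0# F) t) where
  open OrderedField F
  open MTAZRP F
  open OrderedFieldProperties F
  open import Relation.Binary.Reasoning.Setoid setoid

  _≟ᵛ_ : ∀ {n} → DecidableEquality (Vec ℕ n)
  _≟ᵛ_ = Vec.≡-dec ℕ._≟_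

  []-nonNeg : ∀ a → 0# ≤ [ a ]⟨ t ⟩
  []-nonNeg zero    = inj₂ refl
  []-nonNeg (suc a) = +-nonNeg ([]-nonNeg a) (inj₁ (^-pos a 0<t))

  []-suc-pos : ∀ a → 0# < [ suc a ]⟨ t ⟩
  []-suc-pos a = +-nonNeg-pos ([]-nonNeg a) (^-pos a 0<t)

  []!-pos : ∀ a → 0# < [ a ]!⟨ t ⟩
  []!-pos zero    = 0<1
  []!-pos (suc a) = *-pos ([]!-pos a) ([]-suc-pos a)

  -- The geometric sum is split after `d` terms. This is what makes the rates of nested groups of
  -- species telescope.
  []-+ : ∀ d a → [ d ℕ.+ a ]⟨ t ⟩ ≈ [ d ]⟨ t ⟩ + t ^ d * [ a ]⟨ t ⟩
  []-+ d zero    = begin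
    [ d ℕ.+ 0 ]⟨ t ⟩          ≈⟨ reflexive (cong [_]⟨ t ⟩ (ℕ.+-identityʳ d)) ⟩
    [ d ]⟨ t ⟩                ≈⟨ +-identityʳ _ ⟨
    [ d ]⟨ t ⟩ + 0#           ≈⟨ +-congˡ (zeroʳ _) ⟨
    [ d ]⟨ t ⟩ + t ^ d * 0#   ∎
  []-+ d (suc a) = begin
    [ d ℕ.+ suc a ]⟨ t ⟩                                ≈⟨ reflexive (cong [_]⟨ t ⟩ (ℕ.+-suc d a)) ⟩
    [ d ℕ.+ a ]⟨ t ⟩ + t ^ (d ℕ.+ a)                    ≈⟨ +-cong ([]-+ d a) (^-+ d) ⟩
    [ d ]⟨ t ⟩ + t ^ d * [ a ]⟨ t ⟩ + t ^ d * t ^ a     ≈⟨ solve 4 (λ x y z w → x :+ y :* z :+ y :* w := x :+ y :* (z :+ w))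
                                                             refl _ _ _ _ ⟩
    [ d ]⟨ t ⟩ + t ^ d * ([ a ]⟨ t ⟩ + t ^ a)           ∎
    where
    ^-+ : ∀ d → t ^ (d ℕ.+ a) ≈ t ^ d * t ^ a
    ^-+ zero    = sym (*-identityˡ _)
    ^-+ (suc d) = trans (*-congˡ (^-+ d)) (sym (*-assoc _ _ _))

  -- The weight of `a` particles at a site with parameter `y`, chosen so that its successive ratios
  -- are the departure rates (`u-suc`).
  u : Carrier → ℕ → Carrier
  u y a = y ^ a * [ a ]!⟨ t ⟩ ⁻¹

  weight : ∀ {n} → Vector Carrier n → Vec ℕ n → Carrier
  weight x η = product (λ i → u (x i) (lookup η i))

  partition : ∀ {n} → Vector Carrier n → ℕ → Carrier
  partition {n} x M = ∑[ η ∈ compositions n M ] weight x η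

  departure : ∀ {n} → Vector Carrier n → Vec ℕ n → Fin n → Carrier
  departure x η s = x s ⁻¹ * [ lookup η s ]⟨ t ⟩

  u-pos : ∀ {y} a → 0# < y → 0# < u y a
  u-pos a 0<y = *-pos (^-pos a 0<y) (⁻¹-pos ([]!-pos a))

  u-suc : ∀ {y} a → 0# < y → u y (suc a) * (y ⁻¹ * [ suc a ]⟨ t ⟩) ≈ u y a
  u-suc {y} a 0<y = begin
    y * y ^ a * [ suc a ]!⟨ t ⟩ ⁻¹ * (y ⁻¹ * b)   ≈⟨ solve 5 (λ y p i z b → y :* p :* i :* (z :* b) := (y :* z) :* (p :* (b :* i)))
                                                       refl y (y ^ a) ([ suc a ]!⟨ t ⟩ ⁻¹) (y ⁻¹) b ⟩
    y * y ⁻¹ * (y ^ a * (b * [ suc a ]!⟨ t ⟩ ⁻¹)) ≈⟨ *-cong (*-inverseʳ (>⇒≉ 0<y)) (*-congˡ inverse) ⟩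
    1# * (y ^ a * [ a ]!⟨ t ⟩ ⁻¹)                 ≈⟨ *-identityˡ _ ⟩
    y ^ a * [ a ]!⟨ t ⟩ ⁻¹                        ∎
    where
    b = [ suc a ]⟨ t ⟩
    inverse : b * [ suc a ]!⟨ t ⟩ ⁻¹ ≈ [ a ]!⟨ t ⟩ ⁻¹
    -- Multiplied by `[ a ]!⟨ t ⟩` the left-hand side gives 1, because `[ suc a ]!⟨ t ⟩` unfolds to
    -- `[ a ]!⟨ t ⟩ * b`.
    inverse = trans (x*y≈z⇒y≈z/x (>⇒≉ ([]!-pos a))
      (trans (sym (*-assoc _ _ _)) (*-inverseʳ (>⇒≉ ([]!-pos (suc a)))))) (*-identityˡ _)

  weight-pos : ∀ {n} {x : Vector Carrier n} → (∀ s → 0# < x s) → ∀ η → 0# < weight x η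
  weight-pos 0<x η = product-pos _ (λ i → u-pos (lookup η i) (0<x i))

  -- Only the factor of site `s` changes, and `u-suc` absorbs the departure rate into it.
  weight-add : ∀ {n} {x : Vector Carrier n} → (∀ s → 0# < x s) → ∀ ξ s →
               weight x (add ξ s) * departure x (add ξ s) s ≈ weight x ξ
  weight-add {x = x} 0<x (a ∷ ξ) zero = begin
    u (x zero) (suc a) * w * d  ≈⟨ solve 3 (λ u w d → u :* w :* d := u :* d :* w) refl _ _ _ ⟩
    u (x zero) (suc a) * d * w  ≈⟨ *-congʳ (u-suc a (0<x zero)) ⟩
    u (x zero) a * w            ∎
    where
    w = weight (x ∘ suc) ξ
    d = x zero ⁻¹ * [ suc a ]⟨ t ⟩
  weight-add {x = x} 0<x (a ∷ ξ) (suc s) =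
    trans (*-assoc _ _ _) (*-congˡ (weight-add (0<x ∘ suc) ξ s))

  departure≈0 : ∀ {n} (x : Vector Carrier n) η s → lookup η s ≡ 0 → departure x η s ≈ 0#
  departure≈0 x η s eq = trans (*-congˡ (reflexive (cong [_]⟨ t ⟩ eq))) (zeroʳ _)

  -- Each multinomial is `[ M ]!⟨ t ⟩` times inverse factorials, and the latter combine with the
  -- powers of `x` to the product weight.
  H̃≈ : ∀ {n} (x : Vector Carrier n) M → H̃ x t M ≈ [ M ]!⟨ t ⟩ * partition x M
  H̃≈ {n} x M = trans (sumOver-cong (compositions n M) (λ {η} _ → begin
    [ M ]!⟨ t ⟩ * p η ⁻¹ * q η    ≈⟨ *-assoc _ _ _ ⟩
    [ M ]!⟨ t ⟩ * (p η ⁻¹ * q η)  ≈⟨ *-congˡ (trans (*-comm _ _) (*-congˡ (sym (product-⁻¹ _ (λ i → []!-pos (lookup η i)))))) ⟩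
    [ M ]!⟨ t ⟩ * (q η * product (λ i → [ lookup η i ]!⟨ t ⟩ ⁻¹))
                                  ≈⟨ *-congˡ (∏-distrib-* (λ i → x i ^ lookup η i) (λ i → [ lookup η i ]!⟨ t ⟩ ⁻¹)) ⟨
    [ M ]!⟨ t ⟩ * weight x η      ∎)) (sym (*-distribˡ-sumOver (compositions n M) _ _))
    where
    p q : Vec ℕ n → Carrier
    p η = product (λ i → [ lookup η i ]!⟨ t ⟩)
    q η = product (λ i → x i ^ lookup η i)

  -- Adding a particle at `s` is a bijection onto the configurations occupied at `s`, and `f`
  -- vanishes on the others. The bijection is realised by inserting an indicator and exchanging the
  -- two sums.
  sumOver-add : ∀ {n} M (s : Fin n) (f : Vec ℕ n → Carrier) → (∀ η → lookup η s ≡ 0 → f η ≈ 0#) →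
                (∑[ η ∈ compositions n (suc M) ] f η) ≈ (∑[ ξ ∈ compositions n M ] f (add ξ s))
  sumOver-add {n} M s f vanish = begin
    (∑[ η ∈ compositions n (suc M) ] f η)
      ≈⟨ sumOver-cong (compositions n (suc M)) (λ η∈ → sym (fibre _ η∈ _ ≡.refl)) ⟩
    (∑[ η ∈ compositions n (suc M) ] ∑[ ξ ∈ compositions n M ] (δ _≟ᵛ_ (add ξ s) 1# η * f η))
      ≈⟨ sumOver-swap (compositions n (suc M)) (compositions n M) _ ⟩
    (∑[ ξ ∈ compositions n M ] ∑[ η ∈ compositions n (suc M) ] (δ _≟ᵛ_ (add ξ s) 1# η * f η))
      ≈⟨ sumOver-cong (compositions n M) (λ {ξ} ξ∈ → trans
           (sumOver-δ _≟ᵛ_ 1# f (compositions-unique n (suc M))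
              (∈-compositions⁺ _ (≡.trans (sum-add ξ s) (cong suc (∈-compositions⁻ ξ ξ∈)))))
           (*-identityˡ _)) ⟩
    (∑[ ξ ∈ compositions n M ] f (add ξ s)) ∎
    where
    fibre : ∀ η → η ∈ compositions n (suc M) → ∀ a → lookup η s ≡ a →
            (∑[ ξ ∈ compositions n M ] (δ _≟ᵛ_ (add ξ s) 1# η * f η)) ≈ f η
    fibre η η∈ zero    eq = trans
      (sumOver-zero (compositions n M) (λ _ → trans (*-congˡ (vanish η eq)) (zeroʳ _))) (sym (vanish η eq))
    fibre η η∈ (suc a) eq = begin
      (∑[ ξ ∈ compositions n M ] (δ _≟ᵛ_ (add ξ s) 1# η * f η))
        -- For occupied `s`, `add ξ s ≡ η` holds exactly if `η⁻ ≡ ξ`; this turns the indicator into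
        -- one at a fixed point of the summation variable.
        ≈⟨ sumOver-cong (compositions n M) (λ {ξ} _ → *-congʳ (reflexive
             (cong (λ b → if b then 1# else 0#) (does-⇔ (mk⇔
               (λ e → add-injective s (≡.trans (add-remove η s eq) (≡.sym e)))
               (λ e → ≡.trans (cong (λ ζ → add ζ s) (≡.sym e)) (add-remove η s eq)))
               (add ξ s ≟ᵛ η) (η⁻ ≟ᵛ ξ))))) ⟩
      (∑[ ξ ∈ compositions n M ] (δ _≟ᵛ_ η⁻ 1# ξ * f η))
        ≈⟨ sumOver-δ _≟ᵛ_ 1# (λ _ → f η) (compositions-unique n M)
             (∈-compositions⁺ η⁻ (ℕ.suc-injective (≡.trans (≡.sym (sum-add η⁻ s))
               (≡.trans (cong Vec.sum (add-remove η s eq)) (∈-compositions⁻ η η∈))))) ⟩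
      1# * f η
        ≈⟨ *-identityˡ _ ⟩
      f η ∎
      where η⁻ = updateAt η s pred

  -- The substitution `η = add ξ s`, followed by `weight-add`. The resulting weight no longer
  -- depends on `s`.
  sumOver-weight-departure : ∀ {n} {x : Vector Carrier n} → (∀ s → 0# < x s) → ∀ M s (g : Vec ℕ n → Carrier) →
    (∑[ η ∈ compositions n (suc M) ] (weight x η * (departure x η s * g η)))
      ≈ (∑[ ξ ∈ compositions n M ] (weight x ξ * g (add ξ s)))
  sumOver-weight-departure {n} {x} 0<x M s g = trans
    (sumOver-add M s _ (λ η eq → trans (*-congˡ (trans (*-congʳ (departure≈0 x η s eq)) (zeroˡ _))) (zeroʳ _)))
    (sumOver-cong (compositions n M) (λ {ξ} _ → trans (sym (*-assoc _ _ _)) (*-congʳ (weight-add 0<x ξ s))))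

  -- Jump rates and generator under merging.

  rate≈0 : ∀ {n k} (x : Vector Carrier n) (w : Config n k) r s → count w r s ≡ 0 → rate x t w r s ≈ 0#
  rate≈0 x w r s eq = trans (*-congˡ (reflexive (cong [_]⟨ t ⟩ eq))) (zeroʳ _)

  -- Apply `[]-+` with `d` the number of larger particles at `s` and `a` the number of species `j`.
  departure-merge : ∀ {n k} (x : Vector Carrier n) (w : Config n k) j s →
    departure x (merge (toℕ j) w) s ≈ rate x t w j s + departure x (merge (suc (toℕ j)) w) s
  departure-merge x w j s = begin
    x s ⁻¹ * [ lookup (merge (toℕ j) w) s ]⟨ t ⟩  ≈⟨ *-congˡ (reflexive (cong [_]⟨ t ⟩ occupation)) ⟩
    x s ⁻¹ * [ d ℕ.+ a ]⟨ t ⟩                     ≈⟨ *-congˡ ([]-+ d a) ⟩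
    x s ⁻¹ * ([ d ]⟨ t ⟩ + t ^ d * [ a ]⟨ t ⟩)    ≈⟨ solve 4 (λ x y p z → x :* (y :+ p :* z) := x :* p :* z :+ x :* y)
                                                       refl _ _ _ _ ⟩
    rate x t w j s + x s ⁻¹ * [ d ]⟨ t ⟩          ≈⟨ +-congˡ (*-congˡ (reflexive (cong [_]⟨ t ⟩ (lookup-merge (suc (toℕ j)) w s)))) ⟨
    rate x t w j s + departure x (merge (suc (toℕ j)) w) s ∎
    where
    d = countAbove w j s
    a = count w j s
    occupation : lookup (merge (toℕ j) w) s ≡ d ℕ.+ a
    occupation = ≡.trans (lookup-merge (toℕ j) w s) (≡.trans (sumFrom-suc _ j)
      (cong (d ℕ.+_) (Vec.lookup-map j (λ row → lookup row s) w)))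

  -- At an empty site the rate is 0, so the two factors need to agree at occupied sites only. This
  -- absorbs the truncation in `hop`.
  departure-* : ∀ {n} (x : Vector Carrier n) η s {y z : Carrier} →
                (∀ {a} → lookup η s ≡ suc a → y ≈ z) → departure x η s * y ≈ departure x η s * z
  departure-* x η s y≈z with lookup η s in eq
  ... | zero  = trans (trans (*-congʳ (zeroʳ _)) (zeroˡ _)) (sym (trans (*-congʳ (zeroʳ _)) (zeroˡ _)))
  ... | suc a = *-congˡ (y≈z ≡.refl)

  -- The generator applied to g ∘ merge i is the single-species generator
  -- applied to g, with both sides moved so that no subtraction occurs.
  merge-generator : ∀ {n k} (x : Vector Carrier (suc n)) i (w : Config (suc n) k) s (g : Vec ℕ (suc n) → Carrier) →
    sum (λ r → rate x t w r s * g (merge i (jump w r s))) + departure x (merge i w) s * g (merge i w)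
      ≈ departure x (merge i w) s * g (hop (merge i w) s) + sum (λ r → rate x t w r s * g (merge i w))
  merge-generator x i       []        s g = trans (+-comm _ _) (+-congʳ
    (departure-* x (replicate _ 0) s (λ eq → contradiction (≡.trans (≡.sym (Vec.lookup-replicate s 0)) eq) λ ())))
  -- `merge` ignores the species of `row`, so its jumps contribute the same term `r₀ * g η` to both
  -- sides.
  merge-generator x (suc i) (row ∷ w) s g = begin
    r₀ * g η + R′ + D                  ≈⟨ +-assoc _ _ _ ⟩
    r₀ * g η + (R′ + D)                ≈⟨ +-congˡ (merge-generator x i w s g) ⟩
    r₀ * g η + (E + R)                 ≈⟨ solve 3 (λ a e r → a :+ (e :+ r) := e :+ (a :+ r)) refl _ _ _ ⟩
    E + (r₀ * g η + R)                 ∎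
    where
    η = merge i w
    r₀ = rate x t (row ∷ w) zero s
    R′ = sum (λ r → rate x t w r s * g (merge i (jump w r s)))
    R  = sum (λ r → rate x t w r s * g η)
    D  = departure x η s * g η
    E  = departure x η s * g (hop η s)
  merge-generator x zero (row ∷ w) s g = begin
    r₀ * g (zipWith ℕ._+_ (hop row s) ζ) + R′ + departure x η s * g η
      ≈⟨ +-cong (+-congʳ first) (*-congʳ (departure-merge x (row ∷ w) zero s)) ⟩
    r₀ * g (hop η s) + R′ + (r₀ + d) * g η
      ≈⟨ solve 5 (λ r h e d g → r :* h :+ e :+ (r :+ d) :* g := r :* h :+ r :* g :+ (e :+ d :* g)) refl _ _ _ _ _ ⟩
    r₀ * g (hop η s) + r₀ * g η + (R′ + d * g η)
      -- Jumps of the larger species leave `row` in place, so the induction hypothesis is used for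
      -- `g` shifted by `row`.
      ≈⟨ +-congˡ (merge-generator x zero w s (g ∘ zipWith ℕ._+_ row)) ⟩
    r₀ * g (hop η s) + r₀ * g η + (d * g (zipWith ℕ._+_ row (hop ζ s)) + R)
      ≈⟨ +-congˡ (+-congʳ rest) ⟩
    r₀ * g (hop η s) + r₀ * g η + (d * g (hop η s) + R)
      ≈⟨ solve 5 (λ r h g d e → r :* h :+ r :* g :+ (d :* h :+ e) := (r :+ d) :* h :+ (r :* g :+ e)) refl _ _ _ _ _ ⟩
    (r₀ + d) * g (hop η s) + (r₀ * g η + R)
      ≈⟨ +-congʳ (*-congʳ (departure-merge x (row ∷ w) zero s)) ⟨
    departure x η s * g (hop η s) + (r₀ * g η + R) ∎
    where
    ζ = merge zero w
    η = merge zero (row ∷ w)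
    d = departure x ζ s
    r₀ = rate x t (row ∷ w) zero s
    R′ = sum (λ r → rate x t w r s * g (zipWith ℕ._+_ row (merge zero (jump w r s))))
    R  = sum (λ r → rate x t w r s * g η)
    first : r₀ * g (zipWith ℕ._+_ (hop row s) ζ) ≈ r₀ * g (hop η s)
    first with lookup row s in eq
    ... | zero  = trans (trans (*-congʳ (zeroʳ _)) (zeroˡ _)) (sym (trans (*-congʳ (zeroʳ _)) (zeroˡ _)))
    ... | suc a = *-congˡ (reflexive (cong g (zipWith-hop row ζ s eq)))
    rest : d * g (zipWith ℕ._+_ row (hop ζ s)) ≈ d * g (hop η s)
    rest = departure-* x ζ s (λ eq → reflexive (cong g (≡.trans (Vec.zipWith-comm ℕ.+-comm row (hop ζ s))
      (≡.trans (zipWith-hop ζ row s eq) (cong (λ θ → hop θ s) (Vec.zipWith-comm ℕ.+-comm ζ row))))))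

  -- Balance equations for a stationary distribution.

  module Stationary {n k : ℕ} (m : Vec ℕ k) (x : Vector Carrier (suc n)) (0<x : ∀ s → 0# < x s)
                    (π : Config (suc n) k → Carrier) (stationary : IsStationaryMTAZRP x t m π) where
    open IsStationary stationary

    states : List (Config (suc n) k)
    states = configs (suc n) m

    -- Every choice of `s` and `r` has a single target, so the sum over all states collapses to one
    -- over jumps.
    transition-sum : ∀ v (f : Config (suc n) k → Carrier) → v ∈ states →
      (∑[ w ∈ states ] (transition x t v w * f w))
        ≈ sum (λ s → sum (λ r → rate x t v r s * f (jump v r s)))
    transition-sum v f v∈ = begin
      (∑[ w ∈ states ] (transition x t v w * f w))
        ≈⟨ sumOver-cong states (λ {w} _ → trans (*-distribʳ-sum (f w) (λ s → sum (λ r → q s r w)))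
             (sum-cong-≋ (λ s → *-distribʳ-sum (f w) (λ r → q s r w)))) ⟩
      (∑[ w ∈ states ] sum (λ s → sum (λ r → q s r w * f w)))
        ≈⟨ sumOver-sum-swap states {suc n} (λ w s → sum (λ r → q s r w * f w)) ⟩
      sum (λ s → ∑[ w ∈ states ] sum (λ r → q s r w * f w))
        ≈⟨ sum-cong-≋ {suc n} (λ s → trans (sumOver-sum-swap states (λ w r → q s r w * f w))
             (sum-cong-≋ (λ r → single s r _ ≡.refl))) ⟩
      sum (λ s → sum (λ r → rate x t v r s * f (jump v r s))) ∎
      where
      q : Fin (suc n) → Fin k → Config (suc n) k → Carrier
      q s r = δ _≟ᶜ_ (jump v r s) (rate x t v r s)
      single : ∀ s r a → count v r s ≡ a →
               (∑[ w ∈ states ] (q s r w * f w)) ≈ rate x t v r s * f (jump v r s)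
      -- A jump from an empty site creates a particle and leaves `states`, but its rate is 0 and
      -- both sides vanish.
      single s r zero    eq = trans
        (sumOver-zero states (λ {w} _ → trans (*-congʳ (δ-zero _≟ᶜ_ {jump v r s} w (rate≈0 x v r s eq))) (zeroˡ _)))
        (sym (trans (*-congʳ (rate≈0 x v r s eq)) (zeroˡ _)))
      single s r (suc a) eq = sumOver-δ _≟ᶜ_ (rate x t v r s) f (configs-unique (suc n) m)
        (∈-configs⁺ {m = m} (jump v r s) (≡.trans (map-sum-jump v r s eq) (∈-configs⁻ {m = m} v v∈)))

    -- `balance` at `w` is multiplied by `f w` and summed over `w`. It says that the generator
    -- applied to `f` has mean 0 under `π`, with gain and loss on separate sides.
    weak-balance : ∀ (f : Config (suc n) k → Carrier) →
      (∑[ w ∈ states ] (π w * sum (λ s → sum (λ r → rate x t w r s * f (jump w r s)))))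
        ≈ (∑[ w ∈ states ] (π w * sum (λ s → sum (λ r → rate x t w r s * f w))))
    weak-balance f = begin
      (∑[ w ∈ states ] (π w * sum (λ s → sum (λ r → rate x t w r s * f (jump w r s)))))
        ≈⟨ sumOver-cong states (λ {w} w∈ → trans (*-congˡ (sym (transition-sum w f w∈)))
             (*-distribˡ-sumOver states (π w) _)) ⟩
      (∑[ v ∈ states ] ∑[ w ∈ states ] (π v * (transition x t v w * f w)))
        ≈⟨ sumOver-swap states states _ ⟩
      (∑[ w ∈ states ] ∑[ v ∈ states ] (π v * (transition x t v w * f w)))
        ≈⟨ sumOver-cong states (λ {w} w∈ → trans (pull w (λ v → π v) (λ v → transition x t v w))
             (trans (*-congʳ (balance w∈)) (sym (pull w (λ _ → π w) (transition x t w))))) ⟩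
      (∑[ w ∈ states ] ∑[ v ∈ states ] (π w * (transition x t w v * f w)))
        ≈⟨ sumOver-cong states (λ {w} w∈ → trans (sym (*-distribˡ-sumOver states (π w) _))
             (*-congˡ (transition-sum w (λ _ → f w) w∈))) ⟩
      (∑[ w ∈ states ] (π w * sum (λ s → sum (λ r → rate x t w r s * f w)))) ∎
      where
      pull : ∀ w (a b : Config (suc n) k → Carrier) →
             (∑[ v ∈ states ] (a v * (b v * f w))) ≈ (∑[ v ∈ states ] (a v * b v)) * f w
      pull w a b = trans (sumOver-cong states (λ _ → sym (*-assoc _ _ _))) (sym (*-distribʳ-sumOver states (f w) _))

    -- Stationarity of the law of `merge i w` for the single-species process, in tested form:
    -- average `merge-generator` over `π` and cancel `weak-balance` at `g ∘ merge i`.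
    merged-balance : ∀ i (g : Vec ℕ (suc n) → Carrier) →
      sum (λ s → ∑[ w ∈ states ] (π w * (departure x (merge i w) s * g (merge i w))))
        ≈ sum (λ s → ∑[ w ∈ states ] (π w * (departure x (merge i w) s * g (hop (merge i w) s))))
    merged-balance i g = begin
      sum (λ s → ∑[ w ∈ states ] (π w * B w s))   ≈⟨ exchange B ⟩
      (∑[ w ∈ states ] (π w * sum (B w)))         ≈⟨ +-cancelˡ _ _ _ (begin
        ⟪ A ⟫ + ⟪ B ⟫                             ≈⟨ combine A B ⟩
        ⟪ (λ w s → A w s + B w s) ⟫               ≈⟨ sumOver-cong states (λ {w} _ → *-congˡ (sum-cong-≋ (λ s →
                                                       merge-generator x i w s g))) ⟩
        ⟪ (λ w s → C w s + D w s) ⟫               ≈⟨ combine C D ⟨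
        ⟪ C ⟫ + ⟪ D ⟫                             ≈⟨ +-comm _ _ ⟩
        ⟪ D ⟫ + ⟪ C ⟫                             ≈⟨ +-congʳ (weak-balance (g ∘ merge i)) ⟨
        ⟪ A ⟫ + ⟪ C ⟫                             ∎) ⟩
      (∑[ w ∈ states ] (π w * sum (C w)))         ≈⟨ exchange C ⟨
      sum (λ s → ∑[ w ∈ states ] (π w * C w s))   ∎
      where
      ⟪_⟫ : (Config (suc n) k → Fin (suc n) → Carrier) → Carrier
      ⟪ f ⟫ = ∑[ w ∈ states ] (π w * sum (f w))
      A B C D : Config (suc n) k → Fin (suc n) → Carrier
      A w s = sum (λ r → rate x t w r s * g (merge i (jump w r s)))
      B w s = departure x (merge i w) s * g (merge i w)
      C w s = departure x (merge i w) s * g (hop (merge i w) s)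
      D w s = sum (λ r → rate x t w r s * g (merge i w))
      combine : ∀ f h → ⟪ f ⟫ + ⟪ h ⟫ ≈ ⟪ (λ w s → f w s + h w s) ⟫
      combine f h = trans (sym (sumOver-+ states _ _)) (sumOver-cong states (λ {w} _ →
        trans (sym (distribˡ _ _ _)) (*-congˡ (sym (∑-distrib-+ (f w) (h w))))))
      exchange : ∀ f → sum (λ s → ∑[ w ∈ states ] (π w * f w s)) ≈ ⟪ f ⟫
      exchange f = trans (sym (sumOver-sum-swap states {suc n} (λ w s → π w * f w s)))
        (sumOver-cong states (λ {w} _ → sym (*-distribˡ-sum (π w) (f w))))

    merge-∈ : ∀ i {w M} → sumFrom i m ≡ M → w ∈ states → merge i w ∈ compositions (suc n) M
    merge-∈ i {w} eq w∈ = ∈-compositions⁺ _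
      (≡.trans (sum-merge i w) (≡.trans (cong (sumFrom i) (∈-configs⁻ w w∈)) eq))

    -- The merged law with at least one particle: its density is constant.

    module Merged (i : ℕ) {M : ℕ} (sumFrom≡ : sumFrom i m ≡ suc M) where

      many few : List (Vec ℕ (suc n))
      many = compositions (suc n) (suc M)
      few  = compositions (suc n) M

      -- The image of `π` under `merge i`.
      merged : Vec ℕ (suc n) → Carrier
      merged η = ∑[ w ∈ states ] δ _≟ᵛ_ (merge i w) (π w) η

      density : Vec ℕ (suc n) → Carrier
      density η = merged η / weight x η

      weight-density : ∀ η → merged η ≈ weight x η * density η
      weight-density η = begin
        merged η                                    ≈⟨ *-identityʳ _ ⟨
        merged η * 1#                               ≈⟨ *-congˡ (*-inverseʳ (>⇒≉ (weight-pos 0<x η))) ⟨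
        merged η * (weight x η * weight x η ⁻¹)     ≈⟨ solve 3 (λ a b c → a :* (b :* c) := b :* (a :* c)) refl _ _ _ ⟩
        weight x η * density η                      ∎

      -- Change of variables along `merge i`: each state lands on exactly one `η` in `many`, so an
      -- indicator can be inserted.
      merged-sum : ∀ (f : Vec ℕ (suc n) → Carrier) →
                   (∑[ w ∈ states ] (π w * f (merge i w))) ≈ (∑[ η ∈ many ] (weight x η * (density η * f η)))
      merged-sum f = begin
        (∑[ w ∈ states ] (π w * f (merge i w)))
          ≈⟨ sumOver-cong states (λ {w} w∈ → sumOver-δ _≟ᵛ_ (π w) f (compositions-unique (suc n) (suc M)) (merge-∈ i sumFrom≡ w∈)) ⟨
        (∑[ w ∈ states ] ∑[ η ∈ many ] (δ _≟ᵛ_ (merge i w) (π w) η * f η))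
          ≈⟨ sumOver-swap states many _ ⟩
        (∑[ η ∈ many ] ∑[ w ∈ states ] (δ _≟ᵛ_ (merge i w) (π w) η * f η))
          ≈⟨ sumOver-cong many (λ {η} _ → trans (sym (*-distribʳ-sumOver states (f η) _))
               (trans (*-congʳ (weight-density η)) (*-assoc _ _ _))) ⟩
        (∑[ η ∈ many ] (weight x η * (density η * f η))) ∎

      -- Departures from `s` become a sum over the particles `ξ` that stay behind; `density * f`
      -- plays the part of the observable in `sumOver-weight-departure`.
      departure-sum : ∀ s (f : Vec ℕ (suc n) → Carrier) →
        (∑[ w ∈ states ] (π w * (departure x (merge i w) s * f (merge i w))))
          ≈ (∑[ ξ ∈ few ] (weight x ξ * (density (add ξ s) * f (add ξ s))))
      departure-sum s f = begin
        (∑[ w ∈ states ] (π w * (departure x (merge i w) s * f (merge i w))))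
          ≈⟨ merged-sum (λ η → departure x η s * f η) ⟩
        (∑[ η ∈ many ] (weight x η * (density η * (departure x η s * f η))))
          ≈⟨ sumOver-cong many (λ _ → *-congˡ (solve 3 (λ a b c → a :* (b :* c) := b :* (a :* c)) refl _ _ _)) ⟩
        (∑[ η ∈ many ] (weight x η * (departure x η s * (density η * f η))))
          ≈⟨ sumOver-weight-departure 0<x M s (λ η → density η * f η) ⟩
        (∑[ ξ ∈ few ] (weight x ξ * (density (add ξ s) * f (add ξ s)))) ∎

      before after : Vec ℕ (suc n) → Fin (suc n) → Carrier
      before ξ s = density (add ξ s)
      after  ξ s = density (add ξ (next s))

      difference : Vec ℕ (suc n) → Fin (suc n) → Carrier
      difference ξ s = before ξ s - after ξ s

      -- At the square of `difference` this is, up to a constant factor, the Dirichlet form of the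
      -- merged process evaluated at `density`.
      ⟪_⟫ : (Vec ℕ (suc n) → Fin (suc n) → Carrier) → Carrier
      ⟪ f ⟫ = sum (λ s → ∑[ ξ ∈ few ] (weight x ξ * f ξ s))

      ⟪⟫-cong : ∀ {f g} → (∀ ξ s → f ξ s ≈ g ξ s) → ⟪ f ⟫ ≈ ⟪ g ⟫
      ⟪⟫-cong eq = sum-cong-≋ {suc n} (λ s → sumOver-cong few (λ {ξ} _ → *-congˡ {weight x ξ} (eq ξ s)))

      ⟪⟫-+ : ∀ f g → ⟪ (λ ξ s → f ξ s + g ξ s) ⟫ ≈ ⟪ f ⟫ + ⟪ g ⟫
      ⟪⟫-+ f g = trans
        (sum-cong-≋ {suc n} (λ s → trans (sumOver-cong few (λ {ξ} _ → distribˡ (weight x ξ) (f ξ s) (g ξ s)))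
                                         (sumOver-+ few _ _)))
        (∑-distrib-+ {suc n} (λ s → ∑[ ξ ∈ few ] (weight x ξ * f ξ s)) (λ s → ∑[ ξ ∈ few ] (weight x ξ * g ξ s)))

      -- The balance equation tested against the density itself.
      before²≈before*after : ⟪ (λ ξ s → before ξ s * before ξ s) ⟫ ≈ ⟪ (λ ξ s → before ξ s * after ξ s) ⟫
      before²≈before*after = begin
        ⟪ (λ ξ s → before ξ s * before ξ s) ⟫
          ≈⟨ sum-cong-≋ {suc n} (λ s → departure-sum s density) ⟨
        sum (λ s → ∑[ w ∈ states ] (π w * (departure x (merge i w) s * density (merge i w))))
          ≈⟨ merged-balance i density ⟩
        sum (λ s → ∑[ w ∈ states ] (π w * (departure x (merge i w) s * density (hop (merge i w) s))))
          ≈⟨ sum-cong-≋ {suc n} (λ s → departure-sum s (λ η → density (hop η s))) ⟩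
        ⟪ (λ ξ s → before ξ s * density (hop (add ξ s) s)) ⟫
          ≈⟨ ⟪⟫-cong (λ ξ s → *-congˡ {before ξ s} (reflexive (cong density (hop-add ξ s)))) ⟩
        ⟪ (λ ξ s → before ξ s * after ξ s) ⟫ ∎

      -- To avoid subtraction, twice the cross term is added to both sides. The rotation of the ring
      -- and the balance equation turn the two sums of squares into cross terms, which then cancel.
      energy≈0 : ⟪ (λ ξ s → difference ξ s * difference ξ s) ⟫ ≈ 0#
      energy≈0 = +-cancelʳ _ _ _ (begin
        ⟪ d² ⟫ + (⟪ ab ⟫ + ⟪ ab ⟫)                    ≈⟨ +-congˡ (⟪⟫-+ ab ab) ⟨
        ⟪ d² ⟫ + ⟪ (λ ξ s → ab ξ s + ab ξ s) ⟫        ≈⟨ ⟪⟫-+ d² (λ ξ s → ab ξ s + ab ξ s) ⟨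
        ⟪ (λ ξ s → d² ξ s + (ab ξ s + ab ξ s)) ⟫      ≈⟨ ⟪⟫-cong (λ ξ s → polarisation (before ξ s) (after ξ s)) ⟩
        ⟪ (λ ξ s → a² ξ s + b² ξ s) ⟫                 ≈⟨ ⟪⟫-+ a² b² ⟩
        -- `b²` is `a²` at the next site, and `weight x ξ` does not involve the site.
        ⟪ a² ⟫ + ⟪ b² ⟫                               ≈⟨ +-congˡ (sum-next (λ s → ∑[ ξ ∈ few ] (weight x ξ * a² ξ s))) ⟩
        ⟪ a² ⟫ + ⟪ a² ⟫                               ≈⟨ +-cong before²≈before*after before²≈before*after ⟩
        ⟪ ab ⟫ + ⟪ ab ⟫                               ≈⟨ +-identityˡ _ ⟨
        0# + (⟪ ab ⟫ + ⟪ ab ⟫)                        ∎)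
        where
        a² b² ab d² : Vec ℕ (suc n) → Fin (suc n) → Carrier
        a² ξ s = before ξ s * before ξ s
        b² ξ s = after ξ s * after ξ s
        ab ξ s = before ξ s * after ξ s
        d² ξ s = difference ξ s * difference ξ s
        polarisation : ∀ a b → (a - b) * (a - b) + (a * b + a * b) ≈ a * a + b * b
        polarisation a b = begin
          -- Writing `a` as `d + b` leaves an identity of commutative semirings.
          d * d + (a * b + a * b)                  ≈⟨ +-congˡ (+-cong (*-congʳ a≈d+b) (*-congʳ a≈d+b)) ⟩
          d * d + ((d + b) * b + (d + b) * b)      ≈⟨ solve 2 (λ d b → d :* d :+ ((d :+ b) :* b :+ (d :+ b) :* b)
                                                        := (d :+ b) :* (d :+ b) :+ b :* b) refl d b ⟩
          (d + b) * (d + b) + b * b                ≈⟨ +-congʳ (*-cong a≈d+b a≈d+b) ⟨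
          a * a + b * b                            ∎
          where
          d = a - b
          a≈d+b : a ≈ d + b
          a≈d+b = sym (trans (+-assoc a (- b) b) (trans (+-congˡ (-‿inverseˡ b)) (+-identityʳ a)))

      -- All terms of the vanishing energy are nonnegative, so each is 0; dividing by the positive
      -- weight leaves a vanishing square.
      density-next : ∀ {ξ} → ξ ∈ few → ∀ s → density (add ξ s) ≈ density (add ξ (next s))
      density-next {ξ} ξ∈ s = +-cancelʳ (- after ξ s) _ _ (trans
        (square≈0⇒≈0 (x*y≈0⇒y≈0 (>⇒≉ (weight-pos 0<x ξ))
          (sumOver-nonNeg-≈0 few (λ {ξ} _ → term-nonNeg ξ s)
            (sum-nonNeg-≈0 {suc n} (λ s → ∑[ ξ ∈ few ] (weight x ξ * (difference ξ s * difference ξ s)))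
              (λ s → sumOver-nonNeg few (λ {ξ} _ → term-nonNeg ξ s)) energy≈0 s) ξ∈)))
        (sym (-‿inverseʳ (after ξ s))))
        where
        term-nonNeg : ∀ ξ s → 0# ≤ weight x ξ * (difference ξ s * difference ξ s)
        term-nonNeg ξ s = *-nonNeg (weight-pos 0<x ξ) (square-nonNeg (difference ξ s))

      -- Repeated use of `density-next`, from site `zero` up to `s`.
      density-add : ∀ {ξ} → ξ ∈ few → ∀ s → density (add ξ s) ≈ density (add ξ zero)
      density-add {ξ} ξ∈ = <-weakInduction (λ s → density (add ξ s) ≈ density (add ξ zero)) refl
        (λ s ih → trans (reflexive (cong (density ∘ add ξ) (≡.sym (next-inject₁ s))))
                        (trans (sym (density-next ξ∈ (inject₁ s))) ih))

      constant : Carrier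
      constant = density (suc M ∷ replicate n 0)

      -- Particles are brought to site `zero` one at a time without changing `density`, ending at
      -- the reference configuration of `constant`.
      density-constant : ∀ {η} → η ∈ many → density η ≈ constant
      density-constant {b ∷ η} η∈ = collect _ η b ≡.refl (∈-compositions⁻ (b ∷ η) η∈)
        where
        -- Induction on the number `p` of particles away from site `zero`; `b` counts those already
        -- there.
        collect : ∀ p η b → Vec.sum η ≡ p → b ℕ.+ Vec.sum η ≡ suc M → density (b ∷ η) ≈ constant
        collect zero    η b eq total = reflexive (cong density (cong₂ _∷_
          (≡.trans (≡.sym (ℕ.+-identityʳ b)) (≡.trans (cong (b ℕ.+_) (≡.sym eq)) total))
          (sum≡0⇒replicate η eq)))
        collect (suc p) η b eq total with sum≡suc⇒add η eq
        ... | ξ , s , ≡.refl = trans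
          -- By computation `b ∷ add ξ s` is `add (b ∷ ξ) (suc s)`, and `suc b ∷ ξ` is
          -- `add (b ∷ ξ) zero`.
          (density-add (∈-compositions⁺ (b ∷ ξ) (ℕ.suc-injective total′)) (suc s))
          (collect p ξ (suc b) (ℕ.suc-injective (≡.trans (≡.sym (sum-add ξ s)) eq)) total′)
          where
          total′ : suc (b ℕ.+ Vec.sum ξ) ≡ suc M
          total′ = ≡.trans (≡.sym (≡.trans (cong (b ℕ.+_) (sum-add ξ s)) (ℕ.+-suc b _))) total

      -- The total mass of `π` is 1, and the constant density factors out of it.
      normalisation : partition x (suc M) * constant ≈ 1#
      normalisation = begin
        partition x (suc M) * constant                    ≈⟨ *-distribʳ-sumOver many constant _ ⟩
        (∑[ η ∈ many ] (weight x η * constant))           ≈⟨ sumOver-cong many (λ η∈ → *-congˡ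
                                                               (trans (*-identityʳ _) (density-constant η∈))) ⟨
        (∑[ η ∈ many ] (weight x η * (density η * 1#)))   ≈⟨ merged-sum (λ _ → 1#) ⟨
        (∑[ w ∈ states ] (π w * 1#))                      ≈⟨ sumOver-cong states (λ _ → *-identityʳ _) ⟩
        (∑[ w ∈ states ] π w)                             ≈⟨ total ⟩
        1#                                                ∎

      -- The constant density also factors out of `departure-sum`, leaving the partition function
      -- with one particle fewer.
      mean-departure : (∑[ w ∈ states ] (π w * departure x (merge i w) zero)) ≈ partition x M * constant
      mean-departure = begin
        (∑[ w ∈ states ] (π w * departure x (merge i w) zero))
          ≈⟨ sumOver-cong states (λ _ → *-congˡ (*-identityʳ _)) ⟨
        (∑[ w ∈ states ] (π w * (departure x (merge i w) zero * 1#)))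
          ≈⟨ departure-sum zero (λ _ → 1#) ⟩
        (∑[ ξ ∈ few ] (weight x ξ * (density (add ξ zero) * 1#)))
          ≈⟨ sumOver-cong few (λ {ξ} ξ∈ → *-congˡ (trans (*-identityʳ _) (density-constant
               (∈-compositions⁺ (add ξ zero) (≡.trans (sum-add ξ zero) (cong suc (∈-compositions⁻ ξ ξ∈))))))) ⟩
        (∑[ ξ ∈ few ] (weight x ξ * constant))
          ≈⟨ *-distribʳ-sumOver few constant _ ⟨
        partition x M * constant ∎

      -- Follows from `normalisation`: a vanishing partition function would give `0# ≈ 1#`.
      H̃≉0 : ¬ (H̃ x t (suc M) ≈ 0#)
      H̃≉0 eq = 0≉1 (begin
        0#                               ≈⟨ zeroˡ constant ⟨
        0# * constant                    ≈⟨ *-congʳ (x*y≈0⇒y≈0 (>⇒≉ ([]!-pos (suc M))) (trans (sym (H̃≈ x (suc M))) eq)) ⟨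
        partition x (suc M) * constant   ≈⟨ normalisation ⟩
        1#                               ∎)

      mean-departure≈currentTerm : (∑[ w ∈ states ] (π w * departure x (merge i w) zero)) ≈ currentTerm x t (suc M)
      mean-departure≈currentTerm = trans mean-departure (trans
        (x*y≈z⇒y≈z/x H̃≉0 (begin
          H̃ x t (suc M) * (z * constant)                  ≈⟨ *-congʳ (H̃≈ x (suc M)) ⟩
          -- The unfolded `[ suc M ]!⟨ t ⟩` supplies `b`, the factor in front of the quotient in
          -- `currentTerm`.
          [ M ]!⟨ t ⟩ * b * z′ * (z * constant)           ≈⟨ solve 5 (λ f b y z c → f :* b :* y :* (z :* c) := b :* (f :* z) :* (y :* c))
                                                               refl _ _ _ _ _ ⟩
          b * ([ M ]!⟨ t ⟩ * z) * (z′ * constant)         ≈⟨ *-cong (*-congˡ (sym (H̃≈ x M))) normalisation ⟩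
          b * H̃ x t M * 1#                                ≈⟨ *-identityʳ _ ⟩
          b * H̃ x t M                                     ∎))
        (*-assoc _ _ _))
        where
        b  = [ suc M ]⟨ t ⟩
        z  = partition x M
        z′ = partition x (suc M)

    -- From mean departure rates to the current.

    mean-departure : ∀ i → (∑[ w ∈ states ] (π w * departure x (merge i w) zero)) ≈ currentTerm x t (sumFrom i m)
    mean-departure i with sumFrom i m in eq
    ... | suc M = Merged.mean-departure≈currentTerm i eq
    -- No particle remains after merging, as happens above the top species; `currentTerm` is 0 there
    -- by definition.
    ... | zero  = sumOver-zero states (λ {w} w∈ → trans (*-congˡ (departure≈0 x (merge i w) zero
      (sum≡0⇒lookup≡0 (merge i w) zero (∈-compositions⁻ _ (merge-∈ i eq w∈))))) (zeroʳ _))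

    -- Averaging `departure-merge` over `π` gives the current plus `J′` as `J`; hence `J′` is added
    -- and subtracted.
    current≈ : ∀ j → current x t m π j ≈ currentTerm x t (sumFrom (toℕ j) m) - currentTerm x t (sumFrom (suc (toℕ j)) m)
    current≈ j = begin
      current x t m π j                 ≈⟨ +-identityʳ _ ⟨
      current x t m π j + 0#            ≈⟨ +-congˡ (-‿inverseʳ J′) ⟨
      current x t m π j + (J′ - J′)     ≈⟨ +-assoc _ _ _ ⟨
      current x t m π j + J′ - J′       ≈⟨ +-congʳ (begin
        current x t m π j + J′          ≈⟨ +-congˡ (mean-departure (suc (toℕ j))) ⟨
        current x t m π j + (∑[ w ∈ states ] (π w * departure x (merge (suc (toℕ j)) w) zero))
                                        ≈⟨ sumOver-+ states _ _ ⟨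
        (∑[ w ∈ states ] (π w * rate x t w j zero + π w * departure x (merge (suc (toℕ j)) w) zero))
                                        ≈⟨ sumOver-cong states (λ {w} _ → trans (sym (distribˡ _ _ _))
                                             (*-congˡ (sym (departure-merge x w j zero)))) ⟩
        (∑[ w ∈ states ] (π w * departure x (merge (toℕ j) w) zero))
                                        ≈⟨ mean-departure (toℕ j) ⟩
        J                               ∎) ⟩
      J - J′                            ∎
      where
      J  = currentTerm x t (sumFrom (toℕ j) m)
      J′ = currentTerm x t (sumFrom (suc (toℕ j)) m)

theorem7 : ∀ {c ℓ₁ ℓ₂} (F : OrderedField c ℓ₁ ℓ₂) →
    let open OrderedField F
        open MTAZRP F in
    ∀ (n k : ℕ) (m : Vec ℕ k) → All (λ mᵢ → 0 ℕ.< mᵢ) m →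
    (x : Vector Carrier (suc n)) → (∀ s → 0# < x s) →
    (t : Carrier) → 0# < t →
    (π : Config (suc n) k → Carrier) → IsStationaryMTAZRP x t m π →
    (j : Fin k) →
    current x t m π j ≈ currentTerm x t (sumFrom (toℕ j) m) - currentTerm x t (sumFrom (suc (toℕ j)) m)
theorem7 F n k m _ x 0<x t 0<t π stationary =
  ZeroRangeProcess.Stationary.current≈ F t 0<t m x 0<x π stationary
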